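{- Let $G$ be a group. There exist $n\ge1$ and $w\in\mathbb{Q}^n\cap(0,1]^n$ such that $\operatorname{Aut}(K_w)\cong G$ if and only if $G$ is isomorphic to the direct product of finitely many symmetric groups.
   Context: For $w\in\mathbb{Q}^n\cap(0,1]^n$ and $S\subseteq\{1,\dots,n\}$ put $w(S)=\sum_{i\in S}w_i$. $K_w$ is the abstract simplicial complex with vertex set $\{1,\dots,n\}$ in which $S$ is a face iff $w(S)\le 1$. $\operatorname{Aut}(K_w)\le S_n$ is the group of permutations $\sigma$ of $\{1,\dots,n\}$ with $S\in K_w\iff\sigma(S)\in K_w$ for all $S$. "Symmetric groups" means the groups $S_r$ of permutations of a finite set with $r\ge1$ elements. -}

module Defs where

open import Algebra.Bundles using (Group)
import Algebra.Construct.DirectProduct as DirectProduct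
import Algebra.Construct.Terminal as Terminal
open import Algebra.Morphism.Structures using (IsGroupIsomorphism)
open import Data.Bool.Base using (true; false; if_then_else_)
open import Data.Fin.Base using (Fin; zero; suc)
open import Data.Fin.Permutation as Perm using (Permutation′; _⟨$⟩ʳ_; _⟨$⟩ˡ_; _∘ₚ_; flip; inverseˡ; inverseʳ)
open import Data.Fin.Subset using (Subset; _⊆_; ⁅_⁆) renaming (⊥ to ∅)
open import Data.Fin.Subset.Properties using (drop-∷-⊆)
open import Data.List.Base using (List; foldr)
open import Data.Nat.Base using (ℕ)
open import Data.Product.Base using (Σ; _×_; _,_; proj₁; proj₂)
open import Data.Rational.Base using (ℚ; 0ℚ; 1ℚ; _+_; _≤_; _<_; +-0-rawMonoid)
open import Data.Rational.Properties using (+-mono-≤; +-identityˡ; +-identityʳ; ≤-refl; ≤-reflexive; ≤-trans; <⇒≤; nonNegative⁻¹)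
open import Data.Vec.Base using ([]; _∷_; lookup; tabulate; here)
open import Data.Vec.Functional using (Vector)
open import Data.Vec.Properties using (tabulate-cong; lookup∘tabulate; tabulate∘lookup)
open import Function.Base using (_∘_)
open import Function.Bundles using (_⇔_; mk⇔; Equivalence)
open import Level using (Level; 0ℓ; _⊔_)
open import Relation.Binary.PropositionalEquality using (_≡_; refl; sym; trans; cong; subst)

open import Algebra.Definitions.RawMonoid +-0-rawMonoid using (sum)

private
  variable
    n : ℕ
    a b ℓ₁ ℓ₂ : Level

infix 4 _≅_

_≅_ : Group a ℓ₁ → Group b ℓ₂ → Set (a ⊔ b ⊔ ℓ₁ ⊔ ℓ₂)
G ≅ H = Σ (Group.Carrier G → Group.Carrier H) (IsGroupIsomorphism (Group.rawGroup G) (Group.rawGroup H))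

∏ : List (Group 0ℓ 0ℓ) → Group 0ℓ 0ℓ
∏ = foldr DirectProduct.group Terminal.group

-- The library's _∘ₚ_ composes diagrammatically; the product here is the
-- usual (σ ∙ τ)(i) = σ(τ(i)).
Sym : ℕ → Group 0ℓ 0ℓ
Sym n = record
  { Carrier = Permutation′ n
  ; _≈_     = Perm._≈_
  ; _∙_     = λ σ τ → τ ∘ₚ σ
  ; ε       = Perm.id
  ; _⁻¹     = flip
  ; isGroup = record
    { isMonoid = record
      { isSemigroup = record
        { isMagma = record
          { isEquivalence = record
            { refl  = λ _ → refl
            ; sym   = λ p i → sym (p i)
            ; trans = λ p q i → trans (p i) (q i)
            }
          ; ∙-cong = λ {σ} {σ′} {τ} {τ′} p q i → trans (cong (σ ⟨$⟩ʳ_) (q i)) (p (τ′ ⟨$⟩ʳ i))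
          }
        ; assoc = λ _ _ _ _ → refl
        }
      ; identity = (λ _ _ → refl) , (λ _ _ → refl)
      }
    ; inverse = (λ σ _ → inverseˡ σ) , (λ σ _ → inverseʳ σ)
    ; ⁻¹-cong = λ {σ} {τ} p i →
        trans (sym (inverseˡ τ))
          (cong (τ ⟨$⟩ˡ_) (trans (sym (p (σ ⟨$⟩ˡ i))) (inverseʳ σ)))
    }
  }

record SimplicialComplex (n : ℕ) : Set₁ where
  field
    Face        : Subset n → Set
    ∅-face      : Face ∅
    vertex-face : ∀ i → Face ⁅ i ⁆
    ⊆-closed    : ∀ {S T} → S ⊆ T → Face T → Face S

open SimplicialComplex public using (Face)

-- j ∈ σ(S) iff σ⁻¹(j) ∈ S.
image : Permutation′ n → Subset n → Subset n
image σ S = tabulate (λ j → lookup S (σ ⟨$⟩ˡ j))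

IsAutomorphism : SimplicialComplex n → Permutation′ n → Set
IsAutomorphism K σ = ∀ S → Face K S ⇔ Face K (image σ S)

image-id : (S : Subset n) → image Perm.id S ≡ S
image-id = tabulate∘lookup

image-∘ : (σ τ : Permutation′ n) (S : Subset n) → image (τ ∘ₚ σ) S ≡ image σ (image τ S)
image-∘ σ τ S = tabulate-cong λ j → sym (lookup∘tabulate (λ k → lookup S (τ ⟨$⟩ˡ k)) (σ ⟨$⟩ˡ j))

image-inverse : (σ : Permutation′ n) (S : Subset n) → image σ (image (flip σ) S) ≡ S
image-inverse σ S =
  trans (sym (image-∘ σ (flip σ) S))
    (trans (tabulate-cong λ _ → cong (lookup S) (inverseʳ σ)) (image-id S))

module _ (K : SimplicialComplex n) where

  id-isAutomorphism : IsAutomorphism K Perm.id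
  id-isAutomorphism S = mk⇔ (subst (Face K) (sym (image-id S))) (subst (Face K) (image-id S))

  ∘-isAutomorphism : ∀ {σ τ} → IsAutomorphism K σ → IsAutomorphism K τ → IsAutomorphism K (τ ∘ₚ σ)
  ∘-isAutomorphism {σ} {τ} p q S = mk⇔
    (subst (Face K) (sym (image-∘ σ τ S)) ∘ Equivalence.to (p (image τ S)) ∘ Equivalence.to (q S))
    (Equivalence.from (q S) ∘ Equivalence.from (p (image τ S)) ∘ subst (Face K) (image-∘ σ τ S))

  flip-isAutomorphism : ∀ {σ} → IsAutomorphism K σ → IsAutomorphism K (flip σ)
  flip-isAutomorphism {σ} p S = mk⇔
    (Equivalence.from (p (image (flip σ) S)) ∘ subst (Face K) (sym (image-inverse σ S)))
    (subst (Face K) (image-inverse σ S) ∘ Equivalence.to (p (image (flip σ) S)))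

  -- The subgroup of Sym n on the automorphisms: equality ignores the proof
  -- of being an automorphism.
  Aut : Group 0ℓ 0ℓ
  Aut = record
    { Carrier = Σ (Permutation′ n) (IsAutomorphism K)
    ; _≈_     = λ σ τ → proj₁ σ S.≈ proj₁ τ
    ; _∙_     = λ (σ , p) (τ , q) → σ S.∙ τ , ∘-isAutomorphism {σ} {τ} p q
    ; ε       = S.ε , id-isAutomorphism
    ; _⁻¹     = λ (σ , p) → σ S.⁻¹ , flip-isAutomorphism {σ} p
    ; isGroup = record
      { isMonoid = record
        { isSemigroup = record
          { isMagma = record
            { isEquivalence = record
              { refl  = λ {σ} → S.refl {proj₁ σ}
              ; sym   = λ {σ} {τ} → S.sym {proj₁ σ} {proj₁ τ}
              ; trans = λ {σ} {τ} {υ} → S.trans {proj₁ σ} {proj₁ τ} {proj₁ υ}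
              }
            ; ∙-cong = λ {σ} {σ′} {τ} {τ′} → S.∙-cong {proj₁ σ} {proj₁ σ′} {proj₁ τ} {proj₁ τ′}
            }
          ; assoc = λ σ τ υ → S.assoc (proj₁ σ) (proj₁ τ) (proj₁ υ)
          }
        ; identity = (λ σ → S.identityˡ (proj₁ σ)) , (λ σ → S.identityʳ (proj₁ σ))
        }
      ; inverse = (λ σ → S.inverseˡ (proj₁ σ)) , (λ σ → S.inverseʳ (proj₁ σ))
      ; ⁻¹-cong = λ {σ} {τ} → S.⁻¹-cong {proj₁ σ} {proj₁ τ}
      }
    }
    where module S = Group (Sym n)

InUnit : Vector ℚ n → Set
InUnit w = ∀ i → 0ℚ < w i × w i ≤ 1ℚ

weight : Vector ℚ n → Subset n → ℚ
weight w S = sum (λ i → if lookup S i then w i else 0ℚ)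

weight-∅ : (w : Vector ℚ n) → weight w ∅ ≡ 0ℚ
weight-∅ {ℕ.zero}  w = refl
weight-∅ {ℕ.suc n} w = trans (+-identityˡ _) (weight-∅ (w ∘ suc))

weight-⁅⁆ : (w : Vector ℚ n) (i : Fin n) → weight w ⁅ i ⁆ ≡ w i
weight-⁅⁆ w zero    = trans (cong (w zero +_) (weight-∅ (w ∘ suc))) (+-identityʳ (w zero))
weight-⁅⁆ w (suc i) = trans (+-identityˡ _) (weight-⁅⁆ (w ∘ suc) i)

weight-mono : (w : Vector ℚ n) → InUnit w → ∀ {S T} → S ⊆ T → weight w S ≤ weight w T
weight-mono w h {[]}    {[]}    S⊆T = ≤-refl
weight-mono w h {s ∷ S} {t ∷ T} S⊆T =
  +-mono-≤ (head-≤ s t S⊆T) (weight-mono (w ∘ suc) (h ∘ suc) (drop-∷-⊆ S⊆T))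
  where
  head-≤ : ∀ s t → (s ∷ S) ⊆ (t ∷ T) →
           (if s then w zero else 0ℚ) ≤ (if t then w zero else 0ℚ)
  head-≤ false false _ = ≤-refl
  head-≤ false true  _ = <⇒≤ (proj₁ (h zero))
  head-≤ true  true  _ = ≤-refl
  head-≤ true  false p with () ← p here

K : (w : Vector ℚ n) → InUnit w → SimplicialComplex n
K w h = record
  { Face        = λ S → weight w S ≤ 1ℚ
  ; ∅-face      = ≤-trans (≤-reflexive (weight-∅ w)) (nonNegative⁻¹ 1ℚ)
  ; vertex-face = λ i → ≤-trans (≤-reflexive (weight-⁅⁆ w i)) (proj₂ (h i))
  ; ⊆-closed    = λ S⊆T → ≤-trans (weight-mono w h S⊆T)
  }

{-# OPTIONS --safe #-}
module Submission where

-- Call i ≼ j if replacing the vertex j by i in a face always gives a face.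
-- This is a preorder invariant under automorphisms, and in K_w it is total,
-- because w i ≤ w j implies i ≼ j.  A permutation of a finite set preserving a
-- total preorder preserves its equivalence classes; conversely a permutation
-- preserving the classes is a product of transpositions within classes, each
-- of which is an automorphism.  So Aut K_w is the product of the symmetric
-- groups on the classes.
--
-- To realise prescribed class sizes, start from the weights 1, 2, 3, 4, 5 with
-- threshold 8, where all classes are singletons and no vertex is a cone vertex.
-- Repeatedly add a cone vertex and then r isolated vertices: this creates a
-- class of size 1 and one of size r, keeps the old classes, and leaves no
-- cone vertex.

open import Defs
open import Algebra.Bundles using (Group; CommutativeRing)
import Algebra.Construct.DirectProduct as DirectProduct
import Algebra.Morphism.Construct.Composition as Composition
open import Algebra.Morphism.Structures using (IsGroupIsomorphism)
import Algebra.Properties.Group as GroupProperties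
import Algebra.Properties.Semiring.Mult as Mult
open import Data.Bool.Base using (Bool; true; false; if_then_else_)
import Data.Bool.Properties as Bool
open import Data.Empty using (⊥)
open import Data.Fin.Base using (Fin; zero; suc; toℕ; fromℕ<)
open import Data.Fin.Permutation as Perm using (Permutation′; permutation; _⟨$⟩ʳ_; _⟨$⟩ˡ_; _∘ₚ_; flip; inverseˡ; inverseʳ; transpose)
open import Data.Fin.Permutation.Components using (transpose-inverse)
open import Data.Fin.Properties using (_≟_; all?; any?; pigeonhole; toℕ-injective; toℕ-fromℕ<; toℕ<n)
open import Data.Fin.Subset using (Subset) renaming (⊥ to ∅)
open import Data.Fin.Subset.Properties using (anySubset?)
open import Data.List.Base using (List; []; _∷_; map; replicate)
open import Data.List.Relation.Unary.All using (All; []; _∷_)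
open import Data.Nat.Base as ℕ using (ℕ; zero; suc; _≤_; z≤n; s≤s)
import Data.Nat.Properties as ℕ
open import Data.Product.Base as Product using (Σ-syntax; _×_; _,_; proj₁; proj₂)
open import Data.Rational.Base as ℚ using (ℚ; 0ℚ; 1ℚ)
import Data.Rational.Properties as ℚ
open import Data.Sum.Base as Sum using (_⊎_; inj₁; inj₂)
open import Data.Sum.Properties using (inj₁-injective; inj₂-injective)
open import Data.Vec.Base using ([]; _∷_; lookup; _[_]≔_)
open import Data.Vec.Functional using (Vector) renaming ([] to []ᶠ; _∷_ to _∷ᶠ_)
open import Data.Vec.Properties using (tabulate-cong; lookup∘tabulate; tabulate∘lookup; []≔-commutes; []≔-idempotent; []≔-lookup; lookup∘update; lookup∘update′; lookup-replicate)
open import Function.Base using (_∘_; _on_)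
open import Function.Bundles using (_⇔_; mk⇔; Equivalence)
open import Function.Definitions using (Congruent; Injective; Surjective)
open import Level using (Level; 0ℓ)
import Relation.Binary.Construct.On as On
open import Relation.Binary.Core using (Rel)
open import Relation.Binary.Definitions using (Decidable; Total; Transitive; tri<; tri≈; tri>)
open import Relation.Binary.PropositionalEquality using (_≡_; _≢_; _≗_; refl; sym; trans; cong; cong₂; subst; isEquivalence; module ≡-Reasoning)
open import Relation.Binary.Structures using (IsEquivalence)
open import Relation.Nullary using (¬_; Dec; yes; no; contradiction)
open import Relation.Nullary.Decidable using (_×-dec_; _→-dec_; ¬?; decidable-stable; from-yes)
import Relation.Unary as U

private
  variable
    n : ℕ
    rs : List ℕ
    a b d ℓ₁ ℓ₂ ℓ₃ : Level

-- Isomorphisms of groups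

-- Multiplicativity suffices: `f G.ε` is idempotent, hence the unit, and then `f (x G.⁻¹)` is a left
-- inverse of `f x`.
mk≅ : (G : Group a ℓ₁) (H : Group b ℓ₂) → let module G = Group G; module H = Group H in
      (f : G.Carrier → H.Carrier) → Congruent G._≈_ H._≈_ f →
      (∀ x y → f (x G.∙ y) H.≈ f x H.∙ f y) →
      Injective G._≈_ H._≈_ f → Surjective G._≈_ H._≈_ f → G ≅ H
mk≅ G H f f-cong homo injective surjective = f , record
  { isGroupMonomorphism = record
    { isGroupHomomorphism = record
      { isMonoidHomomorphism = record
        { isMagmaHomomorphism = record
          { isRelHomomorphism = record { cong = f-cong }
          ; homo = homo
          }
        ; ε-homo = ε-homo
        }
      ; ⁻¹-homo = λ x → inverseˡ-unique (f (x G.⁻¹)) (f x)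
          (H.trans (H.sym (homo (x G.⁻¹) x)) (H.trans (f-cong (G.inverseˡ x)) ε-homo))
      }
    ; injective = injective
    }
  ; surjective = surjective
  }
  where
  module G = Group G
  module H = Group H
  open GroupProperties H
  ε-homo : f G.ε H.≈ H.ε
  ε-homo = identityˡ-unique (f G.ε) (f G.ε)
    (H.trans (H.sym (homo G.ε G.ε)) (f-cong (G.identityˡ G.ε)))

≅-sym : (G : Group a ℓ₁) (H : Group b ℓ₂) → G ≅ H → H ≅ G
≅-sym G H (f , isIso) = mk≅ H G g
  (λ {x} {y} x≈y → injective (H.trans (f∘g x) (H.trans x≈y (H.sym (f∘g y)))))
  (λ x y → injective (H.trans (f∘g _)
    (H.trans (H.∙-cong (H.sym (f∘g x)) (H.sym (f∘g y))) (H.sym (∙-homo _ _)))))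
  (λ {x} {y} gx≈gy → H.trans (H.sym (f∘g x)) (H.trans (⟦⟧-cong gx≈gy) (f∘g y)))
  (λ x → f x , λ {y} y≈fx → injective (H.trans (f∘g y) y≈fx))
  where
  module G = Group G
  module H = Group H
  open IsGroupIsomorphism isIso
  g : H.Carrier → G.Carrier
  g y = proj₁ (surjective y)
  f∘g : ∀ y → f (g y) H.≈ y
  f∘g y = proj₂ (surjective y) G.refl

≅-trans : (G : Group a ℓ₁) (H : Group b ℓ₂) (I : Group d ℓ₃) → G ≅ H → H ≅ I → G ≅ I
≅-trans G H I (f , f-iso) (g , g-iso) =
  g ∘ f , Composition.isGroupIsomorphism (Group.trans I) f-iso g-iso

_×ᴳ_ : Group 0ℓ 0ℓ → Group 0ℓ 0ℓ → Group 0ℓ 0ℓ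
_×ᴳ_ = DirectProduct.group

×ᴳ-congʳ : (G H I : Group 0ℓ 0ℓ) → H ≅ I → G ×ᴳ H ≅ G ×ᴳ I
×ᴳ-congʳ G H I (f , isIso) = mk≅ (G ×ᴳ H) (G ×ᴳ I) (λ (x , y) → x , f y)
  (λ (p , q) → p , ⟦⟧-cong q)
  (λ _ _ → Group.refl G , ∙-homo _ _)
  (λ (p , q) → p , injective q)
  (λ (x , y) → (x , proj₁ (surjective y)) , λ (p , q) → p , proj₂ (surjective y) q)
  where open IsGroupIsomorphism isIso

-- Discards the singleton classes that the realisation of given class sizes introduces.
Sym1-×ᴳ : (G : Group 0ℓ 0ℓ) → Sym 1 ×ᴳ G ≅ G
Sym1-×ᴳ G = mk≅ (Sym 1 ×ᴳ G) G proj₂ proj₂ (λ _ _ → Group.refl G)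
  (λ {(σ , _)} {(τ , _)} q → (λ i → Fin1-irrelevant (σ ⟨$⟩ʳ i) (τ ⟨$⟩ʳ i)) , q)
  (λ y → (Perm.id , y) , proj₂)
  where
  Fin1-irrelevant : (i j : Fin 1) → i ≡ j
  Fin1-irrelevant zero zero = refl

-- Products of symmetric groups acting on labelled blocks

Block : List ℕ → Set
Block []       = ⊥
Block (r ∷ rs) = Fin r ⊎ Block rs

-- The index of the summand is a plain natural number, so that labels over `rs` and over `grow rs b`
-- can be compared directly.
label : Block rs → ℕ
label {r ∷ rs} (inj₁ _) = 0
label {r ∷ rs} (inj₂ b) = suc (label b)

module ∏Sym (rs : List ℕ) = Group (∏ (map Sym rs))

act : ∏Sym.Carrier rs → Block rs → Block rs
act {r ∷ rs} (σ , g) (inj₁ x) = inj₁ (σ ⟨$⟩ʳ x)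
act {r ∷ rs} (σ , g) (inj₂ b) = inj₂ (act g b)

act-label : (g : ∏Sym.Carrier rs) (b : Block rs) → label (act g b) ≡ label b
act-label {r ∷ rs} (σ , g) (inj₁ x) = refl
act-label {r ∷ rs} (σ , g) (inj₂ b) = cong suc (act-label g b)

act-cong : (g h : ∏Sym.Carrier rs) → ∏Sym._≈_ rs g h → (b : Block rs) → act g b ≡ act h b
act-cong {r ∷ rs} _       _       (p , _) (inj₁ x) = cong inj₁ (p x)
act-cong {r ∷ rs} (_ , g) (_ , h) (_ , q) (inj₂ b) = cong inj₂ (act-cong g h q b)

act-∙ : (g h : ∏Sym.Carrier rs) (b : Block rs) → act (∏Sym._∙_ rs g h) b ≡ act g (act h b)
act-∙ {r ∷ rs} g h (inj₁ x) = refl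
act-∙ {r ∷ rs} (_ , g) (_ , h) (inj₂ b) = cong inj₂ (act-∙ g h b)

act-ε : (b : Block rs) → act (∏Sym.ε rs) b ≡ b
act-ε {r ∷ rs} (inj₁ x) = refl
act-ε {r ∷ rs} (inj₂ b) = cong inj₂ (act-ε b)

act-injective : (g h : ∏Sym.Carrier rs) → (∀ (b : Block rs) → act g b ≡ act h b) → ∏Sym._≈_ rs g h
act-injective {[]}     _       _       _ = _
act-injective {r ∷ rs} (σ , g) (τ , h) p =
  (λ x → inj₁-injective (p (inj₁ x))) , act-injective g h (λ b → inj₂-injective (p (inj₂ b)))

-- A bijection that keeps labels maps every summand to itself. It restricts to a permutation of the
-- first summand and a label-preserving bijection of the others, to which recursion applies.
act-surjective : (f f⁻¹ : Block rs → Block rs) → (∀ b → f (f⁻¹ b) ≡ b) → (∀ b → f⁻¹ (f b) ≡ b) →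
                 (∀ b → label (f b) ≡ label b) → Σ[ g ∈ ∏Sym.Carrier rs ] act g ≗ f
act-surjective {[]}     f f⁻¹ inv inv′ f-label = _ , λ ()
act-surjective {r ∷ rs} f f⁻¹ inv inv′ f-label = (σ , proj₁ rest) , act≗
  where
  f⁻¹-label : ∀ b → label (f⁻¹ b) ≡ label b
  f⁻¹-label b = trans (sym (f-label (f⁻¹ b))) (cong label (inv b))

  inj₁-part : (b : Block (r ∷ rs)) → label b ≡ 0 → Σ[ x ∈ Fin r ] b ≡ inj₁ x
  inj₁-part (inj₁ x) _ = x , refl

  inj₂-part : (b : Block (r ∷ rs)) {k : ℕ} → label b ≡ suc k →
              Σ[ b′ ∈ Block rs ] b ≡ inj₂ b′
  inj₂-part (inj₂ b) _ = b , refl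

  -- Only one inverse law is assumed; exchanging `f` and `f⁻¹` then gives the other law for the
  -- restrictions.
  module Restrict (h h⁻¹ : Block (r ∷ rs) → Block (r ∷ rs)) (h-inv : ∀ b → h (h⁻¹ b) ≡ b)
                  (h-label : ∀ b → label (h b) ≡ label b) (h⁻¹-label : ∀ b → label (h⁻¹ b) ≡ label b) where

    head : ∀ x → Σ[ y ∈ Fin r ] h (inj₁ x) ≡ inj₁ y
    head x = inj₁-part _ (h-label (inj₁ x))

    head⁻¹ : ∀ x → Σ[ y ∈ Fin r ] h⁻¹ (inj₁ x) ≡ inj₁ y
    head⁻¹ x = inj₁-part _ (h⁻¹-label (inj₁ x))

    tail : ∀ b → Σ[ b′ ∈ Block rs ] h (inj₂ b) ≡ inj₂ b′
    tail b = inj₂-part _ (h-label (inj₂ b))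

    tail⁻¹ : ∀ b → Σ[ b′ ∈ Block rs ] h⁻¹ (inj₂ b) ≡ inj₂ b′
    tail⁻¹ b = inj₂-part _ (h⁻¹-label (inj₂ b))

    head-inv : ∀ x → proj₁ (head (proj₁ (head⁻¹ x))) ≡ x
    head-inv x = inj₁-injective (trans (sym (proj₂ (head _)))
      (trans (cong h (sym (proj₂ (head⁻¹ x)))) (h-inv (inj₁ x))))

    tail-inv : ∀ b → proj₁ (tail (proj₁ (tail⁻¹ b))) ≡ b
    tail-inv b = inj₂-injective (trans (sym (proj₂ (tail _)))
      (trans (cong h (sym (proj₂ (tail⁻¹ b)))) (h-inv (inj₂ b))))

  module F   = Restrict f f⁻¹ inv f-label f⁻¹-label
  module F⁻¹ = Restrict f⁻¹ f inv′ f⁻¹-label f-label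

  σ : Permutation′ r
  σ = permutation (proj₁ ∘ F.head) (proj₁ ∘ F⁻¹.head) F.head-inv F⁻¹.head-inv

  rest : Σ[ g ∈ ∏Sym.Carrier rs ] act g ≗ (proj₁ ∘ F.tail)
  rest = act-surjective (proj₁ ∘ F.tail) (proj₁ ∘ F⁻¹.tail) F.tail-inv F⁻¹.tail-inv
    (λ b → ℕ.suc-injective (trans (cong label (sym (proj₂ (F.tail b)))) (f-label (inj₂ b))))

  act≗ : act (σ , proj₁ rest) ≗ f
  act≗ (inj₁ x) = sym (proj₂ (F.head x))
  act≗ (inj₂ b) = trans (cong inj₂ (proj₂ rest b)) (sym (proj₂ (F.tail b)))

-- Enumerating the classes of an equivalence relation on a finite set

record Blocks (R : Rel (Fin n) 0ℓ) (rs : List ℕ) : Set where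
  field
    to      : Fin n → Block rs
    from    : Block rs → Fin n
    to-from : ∀ b → to (from b) ≡ b
    from-to : ∀ i → from (to i) ≡ i
    related : ∀ i j → R i j ⇔ (label (to i) ≡ label (to j))

-- The argument `b` only selects a summand: that summand gains the point `new b`, and `old b` embeds
-- the former points.
grow : (rs : List ℕ) → Block rs → List ℕ
grow (r ∷ rs) (inj₁ _) = suc r ∷ rs
grow (r ∷ rs) (inj₂ b) = r ∷ grow rs b

new : (b : Block rs) → Block (grow rs b)
new {r ∷ rs} (inj₁ _) = inj₁ zero
new {r ∷ rs} (inj₂ b) = inj₂ (new b)

old : (b : Block rs) → Block rs → Block (grow rs b)
old {r ∷ rs} (inj₁ _) (inj₁ x) = inj₁ (suc x)
old {r ∷ rs} (inj₁ _) (inj₂ c) = inj₂ c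
old {r ∷ rs} (inj₂ b) (inj₁ x) = inj₁ x
old {r ∷ rs} (inj₂ b) (inj₂ c) = inj₂ (old b c)

-- Lets the inverse of an enlarged bijection be defined by cases on new and old points;
-- `growView-new` and `growView-old` make it compute.
data GrowView (b : Block rs) : Block (grow rs b) → Set where
  is-new : GrowView b (new b)
  is-old : ∀ c → GrowView b (old b c)

growView : (b : Block rs) (c : Block (grow rs b)) → GrowView b c
growView {r ∷ rs} (inj₁ _) (inj₁ zero)    = is-new
growView {r ∷ rs} (inj₁ _) (inj₁ (suc x)) = is-old (inj₁ x)
growView {r ∷ rs} (inj₁ _) (inj₂ c)       = is-old (inj₂ c)
growView {r ∷ rs} (inj₂ b) (inj₁ x)       = is-old (inj₁ x)
growView {r ∷ rs} (inj₂ b) (inj₂ c) with growView b c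
... | is-new    = is-new
... | is-old c′ = is-old (inj₂ c′)

growView-new : (b : Block rs) → growView b (new b) ≡ is-new
growView-new {r ∷ rs} (inj₁ _) = refl
growView-new {r ∷ rs} (inj₂ b) rewrite growView-new b = refl

growView-old : (b c : Block rs) → growView b (old b c) ≡ is-old c
growView-old {r ∷ rs} (inj₁ _) (inj₁ x) = refl
growView-old {r ∷ rs} (inj₁ _) (inj₂ c) = refl
growView-old {r ∷ rs} (inj₂ b) (inj₁ x) = refl
growView-old {r ∷ rs} (inj₂ b) (inj₂ c) rewrite growView-old b c = refl

label-new : (b : Block rs) → label (new b) ≡ label b
label-new {r ∷ rs} (inj₁ _) = refl
label-new {r ∷ rs} (inj₂ b) = cong suc (label-new b)

label-old : (b c : Block rs) → label (old b c) ≡ label c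
label-old {r ∷ rs} (inj₁ _) (inj₁ x) = refl
label-old {r ∷ rs} (inj₁ _) (inj₂ c) = refl
label-old {r ∷ rs} (inj₂ b) (inj₁ x) = refl
label-old {r ∷ rs} (inj₂ b) (inj₂ c) = cong suc (label-old b c)

grow-positive : All (1 ≤_) rs → (b : Block rs) → All (1 ≤_) (grow rs b)
grow-positive (p ∷ ps) (inj₁ _) = s≤s z≤n ∷ ps
grow-positive (p ∷ ps) (inj₂ b) = p ∷ grow-positive ps b

relabel : {A : Set} {k k′ l l′ : ℕ} → k ≡ k′ → l ≡ l′ → A ⇔ (k ≡ l) → A ⇔ (k′ ≡ l′)
relabel refl refl e = e

module _ {R : Rel (Fin (suc n)) 0ℓ} (isEq : IsEquivalence R) where

  private module R = IsEquivalence isEq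

  addSingleton : Blocks (R on suc) rs → (∀ i → ¬ R zero (suc i)) → Blocks R (1 ∷ rs)
  addSingleton {rs = rs} B alone = record
    { to = to′; from = from′
    ; to-from = λ { (inj₁ zero) → refl ; (inj₂ b) → cong inj₂ (to-from b) }
    ; from-to = λ { zero → refl ; (suc i) → cong suc (from-to i) }
    ; related = λ
      { zero    zero    → mk⇔ (λ _ → refl) (λ _ → R.refl)
      ; zero    (suc j) → mk⇔ (λ p → contradiction p (alone j)) λ ()
      ; (suc i) zero    → mk⇔ (λ p → contradiction (R.sym p) (alone i)) λ ()
      ; (suc i) (suc j) → mk⇔ (cong suc ∘ Equivalence.to (related i j))
                              (Equivalence.from (related i j) ∘ ℕ.suc-injective)
      }
    }
    where
    open Blocks B
    to′ : Fin (suc n) → Block (1 ∷ rs)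
    to′ zero    = inj₁ zero
    to′ (suc i) = inj₂ (to i)
    from′ : Block (1 ∷ rs) → Fin (suc n)
    from′ (inj₁ _) = zero
    from′ (inj₂ b) = suc (from b)

  addTo : (B : Blocks (R on suc) rs) (b : Block rs) →
          (∀ i → R zero (suc i) ⇔ (label b ≡ label (Blocks.to B i))) → Blocks R (grow rs b)
  addTo {rs = rs} B b zero-related = record
    { to = to′; from = from′
    ; to-from = to-from′
    ; from-to = from-to′
    ; related = λ
      { zero    zero    → mk⇔ (λ _ → refl) (λ _ → R.refl)
      ; zero    (suc j) → related₀ j
      ; (suc i) zero    → mk⇔ (sym ∘ Equivalence.to (related₀ i) ∘ R.sym)
                              (R.sym ∘ Equivalence.from (related₀ i) ∘ sym)
      ; (suc i) (suc j) → relabel (sym (label-old b (to i))) (sym (label-old b (to j))) (related i j)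
      }
    }
    where
    open Blocks B
    to′ : Fin (suc n) → Block (grow rs b)
    to′ zero    = new b
    to′ (suc i) = old b (to i)
    related₀ : ∀ i → R zero (suc i) ⇔ (label (to′ zero) ≡ label (to′ (suc i)))
    related₀ i = relabel (sym (label-new b)) (sym (label-old b (to i))) (zero-related i)
    fromView : ∀ {c} → GrowView b c → Fin (suc n)
    fromView is-new     = zero
    fromView (is-old c) = suc (from c)
    from′ : Block (grow rs b) → Fin (suc n)
    from′ c = fromView (growView b c)
    to-from′ : ∀ c → to′ (from′ c) ≡ c
    to-from′ c with growView b c
    ... | is-new    = refl
    ... | is-old c′ = cong (old b) (to-from c′)
    from-to′ : ∀ i → from′ (to′ i) ≡ i
    from-to′ zero    = cong fromView (growView-new b)
    from-to′ (suc i) = trans (cong fromView (growView-old b (to i))) (cong suc (from-to i))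

-- Induction on `n`: once the other points are sorted, `zero` either joins the class of some related
-- point or starts a class of its own.
blocks : (R : Rel (Fin n) 0ℓ) → IsEquivalence R → Decidable R →
         Σ[ rs ∈ List ℕ ] All (1 ≤_) rs × Blocks R rs
blocks {zero}  R isEq R? = [] , [] , record
  { to = λ () ; from = λ () ; to-from = λ () ; from-to = λ () ; related = λ () }
blocks {suc n} R isEq R?
  with blocks (R on suc) (On.isEquivalence suc isEq) (λ i j → R? (suc i) (suc j))
     | any? (λ j → R? zero (suc j))
... | rs , ps , B | no  alone = 1 ∷ rs , s≤s z≤n ∷ ps , addSingleton isEq B (λ i p → alone (i , p))
... | rs , ps , B | yes (j , 0~j) = grow rs (to j) , grow-positive ps (to j) , addTo isEq B (to j) λ i → mk⇔
        (λ 0~i → Equivalence.to (related j i) (R.trans (R.sym 0~j) 0~i))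
        (λ p → R.trans 0~j (Equivalence.from (related j i) p))
  where
  open Blocks B
  module R = IsEquivalence isEq

-- The product acts on `Fin n` by transporting `act` along the bijection of `B`. The relation is
-- left general because it is `_∼_` for arbitrary weights and equality of integer weights for the
-- realisations.
∏Sym≅Aut : (C : SimplicialComplex n) {R : Rel (Fin n) 0ℓ} →
           (∀ σ → IsAutomorphism C σ ⇔ (∀ i → R (σ ⟨$⟩ʳ i) i)) →
           Blocks R rs → ∏ (map Sym rs) ≅ Aut C
∏Sym≅Aut {n} {rs} C {R} aut⇔ B = mk≅ (∏ (map Sym rs)) (Aut C)
  (λ g → perm g , Equivalence.from (aut⇔ (perm g)) (perm-related g))
  (λ {g} {h} p i → cong from (act-cong g h p (to i)))
  (λ g h i → cong from (trans (act-∙ g h (to i)) (cong (act g) (sym (to-from _)))))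
  (λ {g} {h} p → act-injective g h (λ b → begin
    act g b                             ≡⟨ cong (act g) (to-from b) ⟨
    act g (to (from b))                 ≡⟨ to-from _ ⟨
    to (from (act g (to (from b))))     ≡⟨ cong to (p (from b)) ⟩
    to (from (act h (to (from b))))     ≡⟨ to-from _ ⟩
    act h (to (from b))                 ≡⟨ cong (act h) (to-from b) ⟩
    act h b                             ∎))
  (λ (σ , σ-aut) → proj₁ (preimage σ σ-aut) , λ {g} p i →
    trans (cong from (act-cong g _ p (to i))) (proj₂ (preimage σ σ-aut) i))
  where
  open Blocks B
  open ≡-Reasoning
  module G = Group (∏ (map Sym rs))

  conj-inverse : ∀ g h → G._≈_ (g G.∙ h) G.ε → ∀ i → from (act g (to (from (act h (to i))))) ≡ i
  conj-inverse g h gh≈ε i = begin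
    from (act g (to (from (act h (to i))))) ≡⟨ cong (from ∘ act g) (to-from _) ⟩
    from (act g (act h (to i)))             ≡⟨ cong from (act-∙ g h (to i)) ⟨
    from (act (g G.∙ h) (to i))             ≡⟨ cong from (act-cong (g G.∙ h) G.ε gh≈ε (to i)) ⟩
    from (act G.ε (to i))                   ≡⟨ cong from (act-ε (to i)) ⟩
    from (to i)                             ≡⟨ from-to i ⟩
    i                                       ∎

  perm : G.Carrier → Permutation′ n
  perm g = permutation (λ i → from (act g (to i))) (λ i → from (act (g G.⁻¹) (to i)))
    (conj-inverse g (g G.⁻¹) (G.inverseʳ g)) (conj-inverse (g G.⁻¹) g (G.inverseˡ g))

  perm-related : ∀ g i → R (perm g ⟨$⟩ʳ i) i
  perm-related g i = Equivalence.from (related _ _)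
    (trans (cong label (to-from _)) (act-label g (to i)))

  -- Conjugated by the bijection, `σ` becomes a label-preserving bijection of `Block rs`, which
  -- `act-surjective` lifts to the product.
  preimage : ∀ σ → IsAutomorphism C σ → Σ[ g ∈ G.Carrier ] (∀ i → perm g ⟨$⟩ʳ i ≡ σ ⟨$⟩ʳ i)
  preimage σ σ-aut = proj₁ sol , λ i → begin
    from (act (proj₁ sol) (to i))          ≡⟨ cong from (proj₂ sol (to i)) ⟩
    from (to (σ ⟨$⟩ʳ from (to i)))         ≡⟨ from-to _ ⟩
    σ ⟨$⟩ʳ from (to i)                     ≡⟨ cong (σ ⟨$⟩ʳ_) (from-to i) ⟩
    σ ⟨$⟩ʳ i                               ∎
    where
    sol : Σ[ g ∈ G.Carrier ] act g ≗ (λ b → to (σ ⟨$⟩ʳ from b))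
    sol = act-surjective (λ b → to (σ ⟨$⟩ʳ from b)) (λ b → to (σ ⟨$⟩ˡ from b))
      (λ b → trans (cong (to ∘ (σ ⟨$⟩ʳ_)) (from-to _)) (trans (cong to (inverseʳ σ)) (to-from b)))
      (λ b → trans (cong (to ∘ (σ ⟨$⟩ˡ_)) (from-to _)) (trans (cong to (inverseˡ σ)) (to-from b)))
      (λ b → trans (Equivalence.to (related _ _) (Equivalence.to (aut⇔ σ) σ-aut (from b)))
                   (cong label (to-from b)))

-- The vicinal preorder of a simplicial complex

lookup-injective : {S T : Subset n} → lookup S ≗ lookup T → S ≡ T
lookup-injective {S = S} {T} p =
  trans (sym (tabulate∘lookup S)) (trans (tabulate-cong p) (tabulate∘lookup T))

lookup-elsewhere : (S : Subset n) {i j : Fin n} {b c : Bool} → i ≢ j →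
                   lookup S i ≡ b → lookup (S [ j ]≔ c) i ≡ b
lookup-elsewhere S {c = c} i≢j Si = trans (lookup∘update′ i≢j S c) Si

reinsert : (S : Subset n) (i : Fin n) → lookup S i ≡ true → (S [ i ]≔ false) [ i ]≔ true ≡ S
reinsert S i Si = trans ([]≔-idempotent S i) (trans (cong (S [ i ]≔_) (sym Si)) ([]≔-lookup S i))

lookup-image : (σ : Permutation′ n) (S : Subset n) → lookup (image σ S) ≗ (lookup S ∘ (σ ⟨$⟩ˡ_))
lookup-image σ S = lookup∘tabulate _

image-cong : (σ τ : Permutation′ n) → σ Perm.≈ τ → ∀ S → image σ S ≡ image τ S
image-cong σ τ p S = tabulate-cong λ j → cong (lookup S)
  (trans (sym (inverseˡ τ)) (cong (τ ⟨$⟩ˡ_) (trans (sym (p _)) (inverseʳ σ))))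

image-[]≔ : (σ : Permutation′ n) (S : Subset n) (i : Fin n) (b : Bool) →
            image σ (S [ i ]≔ b) ≡ image σ S [ σ ⟨$⟩ʳ i ]≔ b
image-[]≔ σ S i b = lookup-injective pointwise
  where
  pointwise : lookup (image σ (S [ i ]≔ b)) ≗ lookup (image σ S [ σ ⟨$⟩ʳ i ]≔ b)
  pointwise k with k ≟ σ ⟨$⟩ʳ i
  ... | yes refl = trans (lookup-image σ (S [ i ]≔ b) k) (trans (cong (lookup (S [ i ]≔ b)) (inverseˡ σ))
                     (trans (lookup∘update i S b) (sym (lookup∘update _ (image σ S) b))))
  ... | no  k≢σi = trans (lookup-image σ (S [ i ]≔ b) k) (trans (lookup∘update′ σ⁻¹k≢i S b)
                     (sym (trans (lookup∘update′ k≢σi (image σ S) b) (lookup-image σ S k))))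
    where
    σ⁻¹k≢i : σ ⟨$⟩ˡ k ≢ i
    σ⁻¹k≢i p = k≢σi (trans (sym (inverseʳ σ)) (cong (σ ⟨$⟩ʳ_) p))

transpose-at-left : (i j : Fin n) → transpose i j ⟨$⟩ʳ i ≡ j
transpose-at-left i j with i ≟ i
... | yes _   = refl
... | no  i≢i = contradiction refl i≢i

transpose-at-right : (i j : Fin n) → transpose i j ⟨$⟩ʳ j ≡ i
transpose-at-right i j with j ≟ i
... | yes j≡i = j≡i
... | no  _ with j ≟ j
...   | yes _   = refl
...   | no  j≢j = contradiction refl j≢j

transpose-elsewhere : (i j : Fin n) {k : Fin n} → k ≢ i → k ≢ j → transpose i j ⟨$⟩ʳ k ≡ k
transpose-elsewhere i j {k} k≢i k≢j with k ≟ i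
... | yes k≡i = contradiction k≡i k≢i
... | no  _ with k ≟ j
...   | yes k≡j = contradiction k≡j k≢j
...   | no  _   = refl

image-transpose-fixed : (i j : Fin n) (S : Subset n) → lookup S i ≡ lookup S j →
                        image (transpose i j) S ≡ S
image-transpose-fixed i j S Si≡Sj = lookup-injective pointwise
  where
  pointwise : lookup (image (transpose i j) S) ≗ lookup S
  pointwise k with k ≟ j | k ≟ i
  -- `image` applies the inverse, and the inverse of `transpose i j` is `transpose j i`; hence the
  -- order of the arguments.
  ... | yes refl | _        = trans (lookup-image (transpose i j) S k)
                                (trans (cong (lookup S) (transpose-at-left j i)) Si≡Sj)
  ... | no _     | yes refl = trans (lookup-image (transpose i j) S k)
                                (trans (cong (lookup S) (transpose-at-right j i)) (sym Si≡Sj))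
  ... | no k≢j   | no k≢i   = trans (lookup-image (transpose i j) S k)
                                (cong (lookup S) (transpose-elsewhere j i k≢j k≢i))

allSubsets? : {P : Subset n → Set} → U.Decidable P → Dec (∀ S → P S)
allSubsets? P? with anySubset? (¬? ∘ P?)
... | yes (S , ¬PS) = no λ all → ¬PS (all S)
... | no  none      = yes λ S → decidable-stable (P? S) λ ¬PS → none (S , ¬PS)

module Vicinal (C : SimplicialComplex n) where

  infix 4 _≼_ _∼_

  _≼_ : Rel (Fin n) 0ℓ
  i ≼ j = ∀ S → lookup S i ≡ false → lookup S j ≡ false →
          Face C (S [ j ]≔ true) → Face C (S [ i ]≔ true)

  _∼_ : Rel (Fin n) 0ℓ
  i ∼ j = i ≼ j × j ≼ i

  ≼-refl : ∀ {i} → i ≼ i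
  ≼-refl S _ _ F = F

  -- If `j` is not in `S`, the two replacements are made in turn. If it is, `S` is `S′` with `j`
  -- inserted, and the order is reversed: first `i` replaces `j`, then `j` replaces `k`, which
  -- leaves `S` with `i` inserted.
  ≼-trans : Transitive _≼_
  ≼-trans {i} {j} {k} i≼j j≼k S Si Sk F with i ≟ k | lookup S j in Sj
  ... | yes refl | _     = F
  ... | no _     | false = i≼j S Si Sj (j≼k S Sj Sk F)
  ... | no i≢k   | true  = subst (Face C) S′ij≡Si
        (j≼k (S′ [ i ]≔ true) (lookup-elsewhere S′ j≢i S′j) (lookup-elsewhere S′ (i≢k ∘ sym) S′k)
          (subst (Face C) ([]≔-commutes S′ k i (i≢k ∘ sym))
            (i≼j (S′ [ k ]≔ true) (lookup-elsewhere S′ i≢k S′i) (lookup-elsewhere S′ j≢k S′j)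
              (subst (Face C) Sk≡S′kj F))))
    where
    S′ : Subset n
    S′ = S [ j ]≔ false

    true≢false : true ≢ false
    true≢false ()

    j≢i : j ≢ i
    j≢i refl = true≢false (trans (sym Sj) Si)

    j≢k : j ≢ k
    j≢k refl = true≢false (trans (sym Sj) Sk)


    S′j : lookup S′ j ≡ false
    S′j = lookup∘update j S false

    S′i : lookup S′ i ≡ false
    S′i = lookup-elsewhere S (j≢i ∘ sym) Si

    S′k : lookup S′ k ≡ false
    S′k = lookup-elsewhere S (j≢k ∘ sym) Sk

    Sk≡S′kj : S [ k ]≔ true ≡ (S′ [ k ]≔ true) [ j ]≔ true
    Sk≡S′kj = trans (cong (_[ k ]≔ true) (sym (reinsert S j Sj))) ([]≔-commutes S′ j k j≢k)

    S′ij≡Si : (S′ [ i ]≔ true) [ j ]≔ true ≡ S [ i ]≔ true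
    S′ij≡Si = trans ([]≔-commutes S′ i j (j≢i ∘ sym)) (cong (_[ i ]≔ true) (reinsert S j Sj))

  ∼-isEquivalence : IsEquivalence _∼_
  ∼-isEquivalence = record
    { refl  = ≼-refl , ≼-refl
    ; sym   = Product.swap
    ; trans = λ (i≼j , j≼i) (j≼k , k≼j) → ≼-trans i≼j j≼k , ≼-trans k≼j j≼i
    }

  module ∼ = IsEquivalence ∼-isEquivalence

  ∼-dec : U.Decidable (Face C) → Decidable _∼_
  ∼-dec Face? i j = ≼-dec i j ×-dec ≼-dec j i
    where
    ≼-dec : Decidable _≼_
    ≼-dec i j = allSubsets? λ S →
      (lookup S i Bool.≟ false) →-dec ((lookup S j Bool.≟ false) →-dec
        (Face? (S [ j ]≔ true) →-dec Face? (S [ i ]≔ true)))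

  -- Pull `S` back along `σ`, make the replacement there, and push the result forward.
  ≼-automorphism : ∀ σ → IsAutomorphism C σ → ∀ {i j} → i ≼ j → σ ⟨$⟩ʳ i ≼ σ ⟨$⟩ʳ j
  ≼-automorphism σ σ-aut {i} {j} i≼j S Sσi Sσj F =
    subst (Face C) (image-T i) (Equivalence.to (σ-aut (T [ i ]≔ true))
      (i≼j T (trans (lookup-image (flip σ) S i) Sσi) (trans (lookup-image (flip σ) S j) Sσj)
        (Equivalence.from (σ-aut (T [ j ]≔ true)) (subst (Face C) (sym (image-T j)) F))))
    where
    T : Subset n
    T = image (flip σ) S

    image-T : ∀ k → image σ (T [ k ]≔ true) ≡ S [ σ ⟨$⟩ʳ k ]≔ true
    image-T k = trans (image-[]≔ σ T k true) (cong (_[ σ ⟨$⟩ʳ k ]≔ true) (image-inverse σ S))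

  ≼-automorphism⁻¹ : ∀ σ → IsAutomorphism C σ → ∀ {i j} → σ ⟨$⟩ʳ i ≼ σ ⟨$⟩ʳ j → i ≼ j
  ≼-automorphism⁻¹ σ σ-aut {i} {j} p = cancel (≼-automorphism (flip σ) (flip-isAutomorphism C {σ} σ-aut) p)
    where
    cancel : σ ⟨$⟩ˡ (σ ⟨$⟩ʳ i) ≼ σ ⟨$⟩ˡ (σ ⟨$⟩ʳ j) → i ≼ j
    cancel rewrite inverseˡ σ {i} | inverseˡ σ {j} = λ q → q

  -- The orbit i ≼ σ i ≼ σ² i ≼ … runs into itself, so one of its steps, and
  -- hence by invariance the first one, can be reversed.
  ≼-orbit : ∀ σ → IsAutomorphism C σ → ∀ {i} → i ≼ σ ⟨$⟩ʳ i → σ ⟨$⟩ʳ i ≼ i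
  ≼-orbit σ σ-aut {i} i≼σi = reverse (pigeonhole (ℕ.n<1+n n) (orbit ∘ toℕ))
    where
    orbit : ℕ → Fin n
    orbit zero    = i
    orbit (suc m) = σ ⟨$⟩ʳ orbit m

    step : ∀ m → orbit m ≼ orbit (suc m)
    step zero    = i≼σi
    step (suc m) = ≼-automorphism σ σ-aut (step m)

    chain : ∀ {a b} → a ℕ.≤′ b → orbit a ≼ orbit b
    chain ℕ.≤′-refl     = ≼-refl
    chain (ℕ.≤′-step {m} p) = ≼-trans (chain p) (step m)

    rewind : ∀ m → orbit (suc m) ≼ orbit m → orbit 1 ≼ orbit 0
    rewind zero    p = p
    rewind (suc m) p = rewind m (≼-automorphism⁻¹ σ σ-aut p)

    reverse : (Σ[ a ∈ Fin (suc n) ] Σ[ b ∈ Fin (suc n) ] toℕ a ℕ.< toℕ b × orbit (toℕ a) ≡ orbit (toℕ b)) →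
              orbit 1 ≼ orbit 0
    reverse (a , b , a<b , a≡b) =
      rewind (toℕ a) (subst (orbit (suc (toℕ a)) ≼_) (sym a≡b) (chain (ℕ.≤⇒≤′ a<b)))

  -- By totality `i` and its image are comparable. One case is `≼-orbit` for `σ` at `i`, the other
  -- is `≼-orbit` for the inverse at `σ ⟨$⟩ʳ i`.
  automorphism⇒∼ : Total _≼_ → ∀ σ → IsAutomorphism C σ → ∀ i → σ ⟨$⟩ʳ i ∼ i
  automorphism⇒∼ total σ σ-aut i with total i (σ ⟨$⟩ʳ i)
  ... | inj₁ i≼σi = ≼-orbit σ σ-aut i≼σi , i≼σi
  ... | inj₂ σi≼i = σi≼i , back σi≼i
    where
    back : σ ⟨$⟩ʳ i ≼ i → i ≼ σ ⟨$⟩ʳ i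
    back p = subst (_≼ σ ⟨$⟩ʳ i) (inverseˡ σ)
      (≼-orbit (flip σ) (flip-isAutomorphism C {σ} σ-aut)
        (subst (σ ⟨$⟩ʳ i ≼_) (sym (inverseˡ σ)) p))

  -- Permutations within the vicinal classes

  PreservesFaces : Permutation′ n → Set
  PreservesFaces σ = ∀ S → Face C S → Face C (image σ S)

  -- `S` is `T` with `i` inserted, and `τ` takes it to `T` with `j` inserted. Keeping `τ` general
  -- covers a transposition read from either of its two points.
  exchange : ∀ τ {i j} → τ ⟨$⟩ʳ i ≡ j → j ≼ i → ∀ S → lookup S i ≡ true → lookup S j ≡ false →
             (∀ T → lookup T i ≡ false → lookup T j ≡ false → image τ T ≡ T) →
             Face C S → Face C (image τ S)
  exchange τ {i} {j} τi≡j j≼i S Si Sj fixed F = subst (Face C) (sym moved)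
    (j≼i T Tj Ti (subst (Face C) (sym (reinsert S i Si)) F))
    where
    T : Subset n
    T = S [ i ]≔ false

    Ti : lookup T i ≡ false
    Ti = lookup∘update i S false

    Tj : lookup T j ≡ false
    Tj with j ≟ i
    ... | yes refl = Ti
    ... | no  j≢i  = lookup-elsewhere S j≢i Sj

    moved : image τ S ≡ T [ j ]≔ true
    moved = trans (cong (image τ) (sym (reinsert S i Si)))
      (trans (image-[]≔ τ T i true) (cong₂ (_[_]≔ true) (fixed T Ti Tj) τi≡j))

  transpose-preservesFaces : ∀ {i j} → i ∼ j → PreservesFaces (transpose i j)
  transpose-preservesFaces {i} {j} (i≼j , j≼i) S F with lookup S i in Si | lookup S j in Sj
  ... | true  | true  = subst (Face C) (sym (image-transpose-fixed i j S (trans Si (sym Sj)))) F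
  ... | false | false = subst (Face C) (sym (image-transpose-fixed i j S (trans Si (sym Sj)))) F
  ... | true  | false = exchange (transpose i j) (transpose-at-left i j) j≼i S Si Sj
        (λ T Ti Tj → image-transpose-fixed i j T (trans Ti (sym Tj))) F
  ... | false | true  = exchange (transpose i j) (transpose-at-right i j) i≼j S Sj Si
        (λ T Tj Ti → image-transpose-fixed i j T (trans Ti (sym Tj))) F

  -- Induction on the number m of leading points that σ may move; composing
  -- with the transposition of m and σ m makes σ fix m as well.
  ∼⇒preservesFaces : ∀ σ → (∀ i → σ ⟨$⟩ʳ i ∼ i) → PreservesFaces σ
  ∼⇒preservesFaces σ σ∼ = go n ℕ.≤-refl σ σ∼ λ x n≤x → contradiction (toℕ<n x) (ℕ.≤⇒≯ n≤x)
    where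
    go : ∀ m → m ℕ.≤ n → ∀ σ → (∀ i → σ ⟨$⟩ʳ i ∼ i) →
         (∀ x → m ℕ.≤ toℕ x → σ ⟨$⟩ʳ x ≡ x) → PreservesFaces σ
    go zero    _   σ _  fix S F = subst (Face C)
      (sym (trans (image-cong σ Perm.id (λ x → fix x ℕ.z≤n) S) (image-id S))) F
    go (suc m) m<n σ σ∼ fix S F = subst (Face C) σ≡τρ
      (transpose-preservesFaces (∼.sym (σ∼ i)) (image ρ S)
        (go m (ℕ.<⇒≤ m<n) ρ ρ∼ ρ-fix S F))
      where
      i j : Fin n
      i = fromℕ< m<n
      j = σ ⟨$⟩ʳ i
      τ ρ : Permutation′ n
      τ = transpose i j
      ρ = σ ∘ₚ transpose j i

      σ≡τρ : image τ (image ρ S) ≡ image σ S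
      σ≡τρ = trans (sym (image-∘ τ ρ S)) (image-cong (ρ ∘ₚ τ) σ (λ x → transpose-inverse i j) S)

      transpose∼ : ∀ y → transpose j i ⟨$⟩ʳ y ∼ y
      transpose∼ y with y ≟ j
      ... | yes refl = ∼.sym (σ∼ i)
      ... | no _ with y ≟ i
      ...   | yes refl = σ∼ i
      ...   | no _     = ∼.refl

      ρ∼ : ∀ x → ρ ⟨$⟩ʳ x ∼ x
      ρ∼ x = ∼.trans (transpose∼ (σ ⟨$⟩ʳ x)) (σ∼ x)

      -- At `i` the transposition undoes `σ`. A later `x` is fixed by `σ`, and it differs from `j`
      -- by injectivity, so the transposition fixes it too.
      ρ-fix : ∀ x → m ℕ.≤ toℕ x → ρ ⟨$⟩ʳ x ≡ x
      ρ-fix x m≤x with x ≟ i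
      ... | yes refl = transpose-at-left j i
      ... | no  x≢i  = trans (cong (transpose j i ⟨$⟩ʳ_) σx≡x) (transpose-elsewhere j i x≢j x≢i)
        where
        σx≡x : σ ⟨$⟩ʳ x ≡ x
        σx≡x = fix x (ℕ.≤∧≢⇒< m≤x λ m≡x → x≢i (toℕ-injective (trans (sym m≡x) (sym (toℕ-fromℕ< m<n)))))
        x≢j : x ≢ j
        x≢j x≡j = x≢i (trans (sym (inverseˡ σ)) (trans (cong (σ ⟨$⟩ˡ_) (trans σx≡x x≡j)) (inverseˡ σ)))

  -- The inverse also moves points only within classes, so faces are reflected as well as preserved.
  ∼⇒automorphism : ∀ σ → (∀ i → σ ⟨$⟩ʳ i ∼ i) → IsAutomorphism C σ
  ∼⇒automorphism σ σ∼ S = mk⇔ (∼⇒preservesFaces σ σ∼ S)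
    (λ F → subst (Face C) (image-inverse (flip σ) S)
      (∼⇒preservesFaces (flip σ) flip∼ (image σ S) F))
    where
    flip∼ : ∀ i → σ ⟨$⟩ˡ i ∼ i
    flip∼ i = ∼.sym (subst (_∼ σ ⟨$⟩ˡ i) (inverseʳ σ) (σ∼ (σ ⟨$⟩ˡ i)))

-- The vicinal preorder of a weighted complex

weight-insert : (w : Vector ℚ n) (S : Subset n) (i : Fin n) → lookup S i ≡ false →
                weight w (S [ i ]≔ true) ≡ weight w S ℚ.+ w i
weight-insert w (false ∷ S) zero    _  = trans (ℚ.+-comm (w zero) _)
  (cong (ℚ._+ w zero) (sym (ℚ.+-identityˡ (weight (w ∘ suc) S))))
weight-insert w (s ∷ S)     (suc i) Si =
  trans (cong (x ℚ.+_) (weight-insert (w ∘ suc) S i Si)) (sym (ℚ.+-assoc x _ _))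
  where
  x : ℚ
  x = if s then w zero else 0ℚ

module Threshold (w : Vector ℚ n) (h : InUnit w) where

  open Vicinal (K w h) public

  weight-≤⇒≼ : ∀ {i j} → w i ℚ.≤ w j → i ≼ j
  weight-≤⇒≼ {i} {j} wi≤wj S Si Sj F = begin
    weight w (S [ i ]≔ true)   ≡⟨ weight-insert w S i Si ⟩
    weight w S ℚ.+ w i         ≤⟨ ℚ.+-monoʳ-≤ (weight w S) wi≤wj ⟩
    weight w S ℚ.+ w j         ≡⟨ weight-insert w S j Sj ⟨
    weight w (S [ j ]≔ true)   ≤⟨ F ⟩
    1ℚ                         ∎
    where open ℚ.≤-Reasoning

  ≼-total : Total _≼_
  ≼-total i j = Sum.map weight-≤⇒≼ weight-≤⇒≼ (ℚ.≤-total (w i) (w j))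

  automorphism⇔∼ : ∀ σ → IsAutomorphism (K w h) σ ⇔ (∀ i → σ ⟨$⟩ʳ i ∼ i)
  automorphism⇔∼ σ = mk⇔ (automorphism⇒∼ ≼-total σ) (∼⇒automorphism σ)

  _∼?_ : Decidable _∼_
  _∼?_ = ∼-dec (λ S → weight w S ℚ.≤? 1ℚ)

-- Threshold complexes with prescribed class sizes

-- Entries `false` are skipped rather than counted as 0, so that prefixing a witness with `false`
-- keeps its load definitionally.
load : Vector ℕ n → Subset n → ℕ
load u []          = 0
load u (true  ∷ S) = u zero ℕ.+ load (u ∘ suc) S
load u (false ∷ S) = load (u ∘ suc) S

load-∅ : (u : Vector ℕ n) → load u ∅ ≡ 0
load-∅ {zero}  u = refl
load-∅ {suc n} u = load-∅ (u ∘ suc)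

load-double : (u : Vector ℕ n) (S : Subset n) → load ((2 ℕ.*_) ∘ u) S ≡ 2 ℕ.* load u S
load-double u []          = refl
load-double u (true  ∷ S) =
  trans (cong (2 ℕ.* u zero ℕ.+_) (load-double (u ∘ suc) S)) (sym (ℕ.*-distribˡ-+ 2 (u zero) _))
load-double u (false ∷ S) = load-double (u ∘ suc) S

-- `separate` makes vertices of different weight inequivalent. `no-cone` and `nonempty` carry the
-- construction on: they distinguish the next cone vertex from the old vertices and from the next
-- isolated vertex.
record Separated (u : Vector ℕ n) (T : ℕ) : Set where
  field
    positive : ∀ i → 1 ≤ u i
    bounded  : ∀ i → u i ≤ T
    separate : ∀ i j → u i ℕ.< u j → Σ[ S ∈ Subset n ]
               lookup S i ≡ false × lookup S j ≡ false × load u S ℕ.+ u i ≤ T × T ℕ.< load u S ℕ.+ u j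
    no-cone  : ∀ j → Σ[ S ∈ Subset n ] lookup S j ≡ false × load u S ≤ T × T ℕ.< load u S ℕ.+ u j
    nonempty : Σ[ S ∈ Subset n ] 1 ≤ load u S × load u S ≤ T

-- The twin has the weight of `k`, so the old witnesses serve again, with the twin left out.
duplicate-separated : {u : Vector ℕ n} {T : ℕ} → Separated u T → ∀ k → Separated (u k ∷ᶠ u) T
duplicate-separated {n} {u} sep k = record
  { positive = λ { zero → positive k ; (suc i) → positive i }
  ; bounded  = λ { zero → bounded k ; (suc i) → bounded i }
  ; separate = λ
    { zero    zero    lt → contradiction lt (ℕ.<-irrefl refl)
    ; zero    (suc j) lt → let S , _  , Sj , p , q = separate k j lt in false ∷ S , refl , Sj , p , q
    ; (suc i) zero    lt → let S , Si , _  , p , q = separate i k lt in false ∷ S , Si , refl , p , q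
    ; (suc i) (suc j) lt → let S , Si , Sj , p , q = separate i j lt in false ∷ S , Si , Sj , p , q
    }
  ; no-cone  = λ
    { zero    → let S , _  , p , q = no-cone k in false ∷ S , refl , p , q
    ; (suc j) → let S , Sj , p , q = no-cone j in false ∷ S , Sj , p , q
    }
  ; nonempty = let S , p , q = nonempty in false ∷ S , p , q
  }
  where open Separated sep

-- With the threshold raised to 1 + 2T, doubling the old weights makes room for
-- a cone vertex of weight 1; the vertex of weight 1 + 2T is isolated.
extend : Vector ℕ n → ℕ → Vector ℕ (2 ℕ.+ n)
extend u T = (1 ℕ.+ 2 ℕ.* T) ∷ᶠ 1 ∷ᶠ ((2 ℕ.*_) ∘ u)

module _ (u : Vector ℕ n) (T : ℕ) (sep : Separated u T) where

  open Separated sep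

  private
    T′ : ℕ
    T′ = 1 ℕ.+ 2 ℕ.* T

    v : Vector ℕ n
    v = (2 ℕ.*_) ∘ u

    double-≤ : ∀ {a} → a ≤ T → 2 ℕ.* a ≤ 2 ℕ.* T
    double-≤ = ℕ.*-monoʳ-≤ 2

    -- A load above `T` is at least `1 + T`, so its double is at least `2 + 2T` and still exceeds
    -- the raised threshold.
    double-< : ∀ {a} b → T ℕ.< a ℕ.+ b → T′ ℕ.< 2 ℕ.* a ℕ.+ 2 ℕ.* b
    double-< {a} b lt = subst (T′ ℕ.<_) (ℕ.*-distribˡ-+ 2 a b)
      (subst (_≤ 2 ℕ.* (a ℕ.+ b)) (ℕ.*-suc 2 T) (ℕ.*-monoʳ-≤ 2 lt))

    v-positive : ∀ i → 1 ℕ.< v i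
    v-positive i = ℕ.*-monoʳ-≤ 2 (positive i)

    v-bounded : ∀ i → v i ℕ.< T′
    v-bounded i = s≤s (double-≤ (bounded i))

    ∅-avoids : (i : Fin n) → lookup ∅ i ≡ false
    ∅-avoids i = lookup-replicate i false

  extend-separated : Separated (extend u T) T′
  extend-separated = record
    { positive = λ { zero → s≤s z≤n ; (suc zero) → ℕ.≤-refl ; (suc (suc i)) → ℕ.<⇒≤ (v-positive i) }
    ; bounded  = λ { zero → ℕ.≤-refl ; (suc zero) → s≤s z≤n ; (suc (suc i)) → ℕ.<⇒≤ (v-bounded i) }
    ; separate = separate′
    ; no-cone  = no-cone′
    -- The cone vertex alone, of load 1.
    ; nonempty = false ∷ true ∷ ∅ , s≤s z≤n , s≤s (subst (_≤ _) (sym (load-∅ v)) z≤n)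
    }
    where
    separate′ : ∀ i j → extend u T i ℕ.< extend u T j → Σ[ S ∈ Subset (2 ℕ.+ n) ]
      lookup S i ≡ false × lookup S j ≡ false ×
      load (extend u T) S ℕ.+ extend u T i ≤ T′ × T′ ℕ.< load (extend u T) S ℕ.+ extend u T j
    separate′ zero          zero          lt = contradiction lt (ℕ.<-irrefl refl)
    separate′ zero          (suc zero)    lt = contradiction lt (ℕ.≤⇒≯ (s≤s z≤n))
    separate′ zero          (suc (suc j)) lt = contradiction lt (ℕ.<-asym (v-bounded j))
    separate′ (suc zero)    (suc zero)    lt = contradiction lt (ℕ.<-irrefl refl)
    separate′ (suc (suc i)) (suc zero)    lt = contradiction lt (ℕ.<-asym (v-positive i))
    -- Cone against isolated vertex: a doubled face of positive load has room for 1, but not for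
    -- `T′`.
    separate′ (suc zero)    zero          lt with S , p , q ← nonempty =
      false ∷ false ∷ S , refl , refl ,
      subst (_≤ T′) (trans (ℕ.+-comm 1 _) (cong (ℕ._+ 1) (sym (load-double u S)))) (s≤s (double-≤ q)) ,
      ℕ.+-monoˡ-≤ T′ (subst (1 ≤_) (sym (load-double u S)) (ℕ.<⇒≤ (ℕ.*-monoʳ-≤ 2 p)))
    -- Cone against old vertex: a face that `j` cannot join still has room for 1 after doubling.
    separate′ (suc zero)    (suc (suc j)) lt with S , Sj , p , q ← no-cone j =
      false ∷ false ∷ S , refl , Sj ,
      subst (_≤ T′) (trans (ℕ.+-comm 1 _) (cong (ℕ._+ 1) (sym (load-double u S)))) (s≤s (double-≤ p)) ,
      subst (λ l → T′ ℕ.< l ℕ.+ v j) (sym (load-double u S)) (double-< (u j) q)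
    -- Old against isolated vertex: the cone vertex alone can be joined by the former, but not by
    -- the latter, which fills the threshold.
    separate′ (suc (suc i)) zero          lt =
      false ∷ true ∷ ∅ , ∅-avoids i , refl ,
      subst (λ l → 1 ℕ.+ l ℕ.+ v i ≤ T′) (sym (load-∅ v)) (v-bounded i) ,
      s≤s (ℕ.m≤n+m T′ (load v ∅))
    separate′ (suc (suc i)) (suc (suc j)) lt
      with S , Si , Sj , p , q ← separate i j (ℕ.*-cancelˡ-< 2 (u i) (u j) lt) =
      false ∷ false ∷ S , Si , Sj ,
      subst (λ l → l ℕ.+ v i ≤ T′) (sym (load-double u S))
        (subst (_≤ T′) (ℕ.*-distribˡ-+ 2 (load u S) (u i)) (ℕ.m≤n⇒m≤1+n (double-≤ p))) ,
      subst (λ l → T′ ℕ.< l ℕ.+ v j) (sym (load-double u S)) (double-< (u j) q)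

    isolated-full : T′ ℕ.+ load v ∅ ≡ T′
    isolated-full = trans (cong (T′ ℕ.+_) (load-∅ v)) (ℕ.+-identityʳ T′)

    isolated-blocks : ∀ {m} → 1 ≤ m → T′ ℕ.< (T′ ℕ.+ load v ∅) ℕ.+ m
    isolated-blocks {m} 1≤m = subst (λ l → T′ ℕ.< l ℕ.+ m) (sym isolated-full)
      (subst (ℕ._≤ T′ ℕ.+ m) (ℕ.+-comm T′ 1) (ℕ.+-monoʳ-≤ T′ 1≤m))

    no-cone′ : ∀ j → Σ[ S ∈ Subset (2 ℕ.+ n) ] lookup S j ≡ false ×
      load (extend u T) S ≤ T′ × T′ ℕ.< load (extend u T) S ℕ.+ extend u T j
    -- The isolated vertex is incompatible with the cone vertex, and every other vertex with the
    -- isolated one.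
    no-cone′ zero = false ∷ true ∷ ∅ , refl ,
      s≤s (subst (_≤ _) (sym (load-∅ v)) z≤n) , s≤s (ℕ.m≤n+m T′ (load v ∅))
    no-cone′ (suc zero) = true ∷ false ∷ ∅ , refl ,
      ℕ.≤-reflexive isolated-full , isolated-blocks ℕ.≤-refl
    no-cone′ (suc (suc j)) = true ∷ false ∷ ∅ , ∅-avoids j ,
      ℕ.≤-reflexive isolated-full , isolated-blocks (ℕ.<⇒≤ (v-positive j))

  -- Doubling is injective, and the new weights lie strictly below and strictly above all doubled
  -- ones; they differ from each other because `T` is positive.
  extend-blocks : Blocks (_≡_ on u) rs → Blocks (_≡_ on extend u T) (1 ∷ 1 ∷ rs)
  extend-blocks {rs} B =
    addSingleton (On.isEquivalence (extend u T) isEquivalence)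
      (addSingleton (On.isEquivalence (extend u T ∘ suc) isEquivalence) doubled
        λ i → ℕ.<⇒≢ (v-positive i))
      λ { zero    p → ℕ.<⇒≢ 1<T′ (sym p)
        ; (suc i) p → ℕ.<⇒≢ (v-bounded i) (sym p) }
    where
    open Blocks B

    1<T′ : 1 ℕ.< T′
    1<T′ = s≤s (ℕ.≤-trans (let _ , p , q = nonempty in ℕ.≤-trans p q) (ℕ.m≤m+n T _))

    doubled : Blocks (_≡_ on v) rs
    doubled = record
      { to = to ; from = from ; to-from = to-from ; from-to = from-to
      ; related = λ i j → mk⇔ (Equivalence.to (related i j) ∘ ℕ.*-cancelˡ-≡ (u i) (u j) 2)
                              (cong (2 ℕ.*_) ∘ Equivalence.from (related i j))
      }

record Realisation (rs : List ℕ) : Set where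
  constructor realisation
  field
    {size}    : ℕ
    weights   : Vector ℕ size
    threshold : ℕ
    separated : Separated weights threshold
    classes   : Blocks (_≡_ on weights) rs

base : Realisation (1 ∷ 1 ∷ 1 ∷ 1 ∷ 1 ∷ [])
base = realisation u 8 separated
  -- The list of class sizes found by `blocks` evaluates to five ones.
  (proj₂ (proj₂ (blocks (_≡_ on u) (On.isEquivalence u isEquivalence) (λ i j → u i ℕ.≟ u j))))
  where
  u : Vector ℕ 5
  u = 1 ∷ᶠ 2 ∷ᶠ 3 ∷ᶠ 4 ∷ᶠ 5 ∷ᶠ []ᶠ

  separated : Separated u 8
  separated = record
    { positive = from-yes (all? λ i → 1 ℕ.≤? u i)
    ; bounded  = from-yes (all? λ i → u i ℕ.≤? 8)
    ; separate = from-yes (all? λ i → all? λ j → (u i ℕ.<? u j) →-dec anySubset? λ S →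
        (lookup S i Bool.≟ false) ×-dec (lookup S j Bool.≟ false) ×-dec
        (load u S ℕ.+ u i ℕ.≤? 8) ×-dec (8 ℕ.<? load u S ℕ.+ u j))
    ; no-cone  = from-yes (all? λ j → anySubset? λ S →
        (lookup S j Bool.≟ false) ×-dec (load u S ℕ.≤? 8) ×-dec (8 ℕ.<? load u S ℕ.+ u j))
    ; nonempty = from-yes (anySubset? λ S → (1 ℕ.≤? load u S) ×-dec (load u S ℕ.≤? 8))
    }

-- Adds `r` twins of a vertex of the first class, one at a time.
enlarge : ∀ r → Realisation (1 ∷ rs) → Realisation (suc r ∷ rs)
enlarge zero    𝓡 = 𝓡
enlarge (suc r) 𝓡 with realisation u T sep B ← enlarge r 𝓡 =
  realisation (u k ∷ᶠ u) T (duplicate-separated sep k)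
    (addTo (On.isEquivalence (u k ∷ᶠ u) isEquivalence) B (inj₁ zero) λ i →
      relabel (cong label (to-from (inj₁ zero))) refl (related k i))
  where
  open Blocks B
  k = from (inj₁ zero)

-- The class sizes actually obtained: five singletons from `base`, and a singleton cone vertex
-- beside each class of size `r`.
pad : List ℕ → List ℕ
pad []       = 1 ∷ 1 ∷ 1 ∷ 1 ∷ 1 ∷ []
pad (r ∷ rs) = r ∷ 1 ∷ pad rs

realise : All (1 ≤_) rs → Realisation (pad rs)
realise []                         = base
-- `extend` already supplies the first isolated vertex, so only `r` twins are needed for size
-- `suc r`.
realise (s≤s {n = r} z≤n ∷ ps) with realisation u T sep B ← realise ps =
  enlarge r (realisation (extend u T) _ (extend-separated u T sep) (extend-blocks u T sep B))

∏Sym-pad : (rs : List ℕ) → ∏ (map Sym (pad rs)) ≅ ∏ (map Sym rs)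
∏Sym-pad [] = ones 5
  where
  ones : ∀ m → ∏ (map Sym (replicate m 1)) ≅ ∏ []
  ones zero    = mk≅ (∏ []) (∏ []) (λ x → x) (λ p → p) (λ _ _ → _) (λ p → p) (λ x → x , λ p → p)
  ones (suc m) = ≅-trans (∏ (map Sym (replicate (suc m) 1))) (∏ (map Sym (replicate m 1))) (∏ [])
    (Sym1-×ᴳ (∏ (map Sym (replicate m 1)))) (ones m)
∏Sym-pad (r ∷ rs) = ×ᴳ-congʳ (Sym r) (Sym 1 ×ᴳ ∏ (map Sym (pad rs))) (∏ (map Sym rs))
  (≅-trans (Sym 1 ×ᴳ ∏ (map Sym (pad rs))) (∏ (map Sym (pad rs))) (∏ (map Sym rs))
    (Sym1-×ᴳ (∏ (map Sym (pad rs)))) (∏Sym-pad rs))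

-- From integer weights to rational weights

open Mult (CommutativeRing.semiring ℚ.+-*-commutativeRing)
  using (×-homo-+; ×-assoc-*) renaming (_×_ to _·_)

module _ {c : ℚ} (0<c : 0ℚ ℚ.< c) where

  ·-nonNegative : ∀ m → 0ℚ ℚ.≤ m · c
  ·-nonNegative zero    = ℚ.≤-refl
  ·-nonNegative (suc m) = ℚ.≤-trans (·-nonNegative m)
    (subst (ℚ._≤ c ℚ.+ m · c) (ℚ.+-identityˡ (m · c)) (ℚ.+-monoˡ-≤ (m · c) (ℚ.<⇒≤ 0<c)))

  ·-mono-≤ : ∀ {l m} → l ≤ m → l · c ℚ.≤ m · c
  ·-mono-≤ {m = m} z≤n     = ·-nonNegative m
  ·-mono-≤         (s≤s p) = ℚ.+-monoʳ-≤ c (·-mono-≤ p)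

  ·-mono-< : ∀ {l m} → l ℕ.< m → l · c ℚ.< m · c
  ·-mono-< {l} {m} l<m = ℚ.<-≤-trans
    (subst (ℚ._< c ℚ.+ l · c) (ℚ.+-identityˡ (l · c)) (ℚ.+-monoˡ-< (l · c) 0<c)) (·-mono-≤ l<m)

unit-fraction : ∀ {T} → 1 ≤ T → Σ[ c ∈ ℚ ] 0ℚ ℚ.< c × T · c ≡ 1ℚ
unit-fraction {T} 1≤T = 1/q , ℚ.positive⁻¹ 1/q {{ℚ.1/pos⇒pos q}} , (begin
    T · 1/q             ≡⟨ cong (T ·_) (ℚ.*-identityˡ 1/q) ⟨
    T · (1ℚ ℚ.* 1/q)    ≡⟨ ×-assoc-* T 1ℚ 1/q ⟨
    q ℚ.* 1/q           ≡⟨ ℚ.*-inverseʳ q ⟩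
    1ℚ                  ∎)
  where
  open ≡-Reasoning
  q : ℚ
  -- The natural number `T` as a rational; the required unit is its reciprocal.
  q = T · 1ℚ
  instance
    q-positive : ℚ.Positive q
    q-positive = ℚ.positive (·-mono-< (ℚ.positive⁻¹ 1ℚ) 1≤T)
    q-nonZero : ℚ.NonZero q
    q-nonZero = ℚ.pos⇒nonZero q
  1/q : ℚ
  1/q = ℚ.1/ q

weight-· : ∀ c (u : Vector ℕ n) (S : Subset n) → weight (λ i → u i · c) S ≡ load u S · c
weight-· c u []          = refl
weight-· c u (true  ∷ S) = trans (cong (u zero · c ℚ.+_) (weight-· c (u ∘ suc) S))
  (sym (×-homo-+ c (u zero) (load (u ∘ suc) S)))
weight-· c u (false ∷ S) = trans (ℚ.+-identityˡ _) (weight-· c (u ∘ suc) S)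

module Realised {rs : List ℕ} (𝓡 : Realisation rs) where

  open Realisation 𝓡 renaming (weights to u; threshold to T)
  open Separated separated

  private
    fraction : Σ[ c ∈ ℚ ] 0ℚ ℚ.< c × T · c ≡ 1ℚ
    fraction = unit-fraction (let _ , p , q = nonempty in ℕ.≤-trans p q)

    c : ℚ
    c = proj₁ fraction

    0<c : 0ℚ ℚ.< c
    0<c = proj₁ (proj₂ fraction)

    Tc≡1 : T · c ≡ 1ℚ
    Tc≡1 = proj₂ (proj₂ fraction)

  w : Vector ℚ size
  -- Division by `T` turns the threshold `T` into 1.
  w i = u i · c

  w-inUnit : InUnit w
  w-inUnit i = ·-mono-< 0<c (positive i) , subst (w i ℚ.≤_) Tc≡1 (·-mono-≤ 0<c (bounded i))

  open Threshold w w-inUnit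

  weight-insert-· : ∀ S i → lookup S i ≡ false → weight w (S [ i ]≔ true) ≡ (load u S ℕ.+ u i) · c
  weight-insert-· S i Si = trans (weight-insert w S i Si)
    (trans (cong (ℚ._+ w i) (weight-· c u S)) (sym (×-homo-+ c (load u S) (u i))))

  -- The separating set stays a face with `i` inserted but not with `j`.
  lighter-⋠ : ∀ {i j} → u i ℕ.< u j → ¬ j ≼ i
  lighter-⋠ {i} {j} ui<uj j≼i with S , Si , Sj , p , q ← separate i j ui<uj =
    ℚ.<-irrefl refl (ℚ.<-≤-trans
           (subst (1ℚ ℚ.<_) (sym (weight-insert-· S j Sj))
             (subst (ℚ._< (load u S ℕ.+ u j) · c) Tc≡1 (·-mono-< 0<c q)))
           (j≼i S Sj Si (subst (ℚ._≤ 1ℚ) (sym (weight-insert-· S i Si))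
             (subst ((load u S ℕ.+ u i) · c ℚ.≤_) Tc≡1 (·-mono-≤ 0<c p)))))

  ∼⇒≡ : ∀ {i j} → i ∼ j → u i ≡ u j
  ∼⇒≡ {i} {j} (i≼j , j≼i) with ℕ.<-cmp (u i) (u j)
  ... | tri< lt _ _ = contradiction j≼i (lighter-⋠ lt)
  ... | tri≈ _ eq _ = eq
  ... | tri> _ _ gt = contradiction i≼j (lighter-⋠ gt)

  ≡⇒∼ : ∀ {i j} → u i ≡ u j → i ∼ j
  ≡⇒∼ p = weight-≤⇒≼ (ℚ.≤-reflexive (cong (_· c) p)) , weight-≤⇒≼ (ℚ.≤-reflexive (cong (_· c) (sym p)))

  ∏Sym≅Aut-K : ∏ (map Sym rs) ≅ Aut (K w w-inUnit)
  ∏Sym≅Aut-K = ∏Sym≅Aut (K w w-inUnit)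
    (λ σ → mk⇔ (λ a i → ∼⇒≡ (Equivalence.to (automorphism⇔∼ σ) a i))
               (λ p → Equivalence.from (automorphism⇔∼ σ) (λ i → ≡⇒∼ (p i))))
    classes

  -- On an empty vertex set no load is positive, contrary to `nonempty`.
  size-positive : 1 ≤ size
  size-positive with proj₁ nonempty | proj₁ (proj₂ nonempty)
  ... | _ ∷ _ | _ = s≤s z≤n

theorem1p3 : ∀ {c ℓ} (G : Group c ℓ) →
    (Σ[ n ∈ ℕ ] 1 ≤ n × (Σ[ w ∈ Vector ℚ n ] Σ[ h ∈ InUnit w ] Aut (K w h) ≅ G))
    ⇔
    (Σ[ rs ∈ List ℕ ] All (1 ≤_) rs × G ≅ ∏ (map Sym rs))
theorem1p3 G = mk⇔ product realised
  where
  product : (Σ[ n ∈ ℕ ] 1 ≤ n × (Σ[ w ∈ Vector ℚ n ] Σ[ h ∈ InUnit w ] Aut (K w h) ≅ G)) →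
            Σ[ rs ∈ List ℕ ] All (1 ≤_) rs × G ≅ ∏ (map Sym rs)
  product (n , _ , w , h , Aut≅G) =
    let open Threshold w h
        rs , ps , B = blocks _∼_ ∼-isEquivalence _∼?_
    in rs , ps , ≅-sym (∏ (map Sym rs)) G
         (≅-trans (∏ (map Sym rs)) (Aut (K w h)) G (∏Sym≅Aut (K w h) automorphism⇔∼ B) Aut≅G)

  realised : (Σ[ rs ∈ List ℕ ] All (1 ≤_) rs × G ≅ ∏ (map Sym rs)) →
             Σ[ n ∈ ℕ ] 1 ≤ n × (Σ[ w ∈ Vector ℚ n ] Σ[ h ∈ InUnit w ] Aut (K w h) ≅ G)
  realised (rs , ps , G≅∏) =
    _ , size-positive , w , w-inUnit ,
    ≅-trans A P G (≅-trans A P′ P (≅-sym P′ A ∏Sym≅Aut-K) (∏Sym-pad rs)) (≅-sym G P G≅∏)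
    where
    open Realised (realise ps)
    A  = Aut (K w w-inUnit)
    P  = ∏ (map Sym rs)
    P′ = ∏ (map Sym (pad rs))
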